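{- For any finite $\mathbf{A} \in \mathsf{CIdInRL}$, $\langle A, \sqsubseteq \rangle$ is a distributive semilattice.
   Context: A commutative idempotent involutive residuated lattice is an algebra $\mathbf{A}=\langle A,\wedge,\vee,\cdot,\to,1,0\rangle$ such that $\langle A,\wedge,\vee\rangle$ is a lattice (with lattice order $\leq$), $\langle A,\cdot,1\rangle$ is a commutative monoid with $x\cdot x=x$ for all $x$, residuation holds ($x\cdot y\leq z \iff y\leq x\to z$), and, writing $-x := x\to 0$, one has $-{ - }x=x$ for all $x$. The class of these algebras is $\mathsf{CIdInRL}$. The monoidal order is $x\sqsubseteq y :\Leftrightarrow x\cdot y=x$; it is a meet-semilattice order with meet $\cdot$. The semilattice $\langle A,\sqsubseteq\rangle$ is called distributive if for all $x,y,z\in A$ with $x\cdot y\sqsubseteq z$ there exist $x',y'\in A$ such that $x\sqsubseteq x'$, $y\sqsubseteq y'$ and $z=x'\cdot y'$. -}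

module Defs where

open import Algebra.Core using (Op₂)
import Algebra.Definitions as AlgebraDefinitions
import Algebra.Structures as AlgebraStructures
import Algebra.Lattice.Structures as LatticeStructures
open import Data.Fin.Base using (Fin)
open import Data.Nat.Base using (ℕ)
open import Data.Product.Base using (_×_; ∃; ∃-syntax)
open import Function.Bundles using (Inverse; _⇔_)
open import Level using (Level; _⊔_) renaming (suc to lsuc)
open import Relation.Binary.Bundles using (Setoid)
open import Relation.Binary.Core using (Rel)
import Relation.Binary.Construct.NaturalOrder.Left as NaturalOrder
import Relation.Binary.Lattice.Structures as OrderStructures
import Relation.Binary.PropositionalEquality as ≡

-- The number of elements is counted up to the setoid equality.
Finite : ∀ {c ℓ : Level} → Setoid c ℓ → Set (c ⊔ ℓ)
Finite S = ∃ λ (n : ℕ) → Inverse S (≡.setoid (Fin n))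

record IsCIdInRL {c ℓ : Level} {A : Set c} (_≈_ : Rel A ℓ)
                 (_∧_ _∨_ _·_ _⇒_ : Op₂ A) (1# 0# : A) : Set (c ⊔ ℓ) where

  open AlgebraDefinitions _≈_
  open AlgebraStructures _≈_
  open LatticeStructures _≈_

  -- The library's natural order: x ≤ y unfolds to x ≈ (x ∧ y).
  infix 4 _≤_
  _≤_ : Rel A ℓ
  _≤_ = NaturalOrder._≤_ _≈_ _∧_

  -_ : A → A
  - x = x ⇒ 0#

  -- The monoid laws are listed separately so that the equality carries a
  -- single equivalence proof, the one in isLattice.
  field
    isLattice      : IsLattice _∨_ _∧_
    ·-cong         : Congruent₂ _·_
    ·-assoc        : Associative _·_
    ·-identity     : Identity 1# _·_
    ·-comm         : Commutative _·_
    ·-idem         : Idempotent _·_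
    ⇒-cong         : Congruent₂ _⇒_
    residuation    : ∀ x y z → ((x · y) ≤ z) ⇔ (y ≤ (x ⇒ z))
    involutive     : ∀ x → (- (- x)) ≈ x

  open IsLattice isLattice public

  ·-isIdempotentCommutativeMonoid : IsIdempotentCommutativeMonoid _·_ 1#
  ·-isIdempotentCommutativeMonoid = record
    { isCommutativeMonoid = record
      { isMonoid = record
        { isSemigroup = record
          { isMagma = record
            { isEquivalence = isEquivalence
            ; ∙-cong        = ·-cong
            }
          ; assoc = ·-assoc
          }
        ; identity = ·-identity
        }
      ; comm = ·-comm
      }
    ; idem = ·-idem
    }

record CIdInRL (c ℓ : Level) : Set (lsuc (c ⊔ ℓ)) where
  infix  4 _≈_ _⊑_
  infixr 5 _⇒_
  infixr 6 _∨_
  infixr 7 _∧_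
  infixl 8 _·_
  field
    Carrier   : Set c
    _≈_       : Rel Carrier ℓ
    _∧_       : Op₂ Carrier
    _∨_       : Op₂ Carrier
    _·_       : Op₂ Carrier
    _⇒_       : Op₂ Carrier
    1#        : Carrier
    0#        : Carrier
    isCIdInRL : IsCIdInRL _≈_ _∧_ _∨_ _·_ _⇒_ 1# 0#

  open IsCIdInRL isCIdInRL public

  setoid : Setoid c ℓ
  setoid = record { isEquivalence = isEquivalence }

  -- The monoidal order, in general different from the lattice order _≤_.
  _⊑_ : Rel Carrier ℓ
  x ⊑ y = x · y ≈ x

record IsDistributiveMeetSemilattice
         {a ℓ₁ ℓ₂ : Level} {A : Set a}
         (_≈_ : Rel A ℓ₁) (_≤_ : Rel A ℓ₂) (_∧_ : Op₂ A)
         : Set (a ⊔ ℓ₁ ⊔ ℓ₂) where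
  field
    isMeetSemilattice : OrderStructures.IsMeetSemilattice _≈_ _≤_ _∧_
    distributive      : ∀ x y z → (x ∧ y) ≤ z →
                        ∃[ x′ ] ∃[ y′ ] (x ≤ x′ × y ≤ y′ × z ≈ (x′ ∧ y′))

{-# OPTIONS --safe #-}
module Submission where

open import Defs

open import Algebra.Bundles using (IdempotentCommutativeMonoid)
open import Algebra.Lattice.Bundles using (Lattice; Semilattice)
import Algebra.Lattice.Properties.Lattice as LatticeProperties
import Algebra.Lattice.Properties.Semilattice as SemilatticeProperties
import Algebra.Properties.CommutativeSemigroup as CommutativeSemigroupProperties
import Algebra.Solver.IdempotentCommutativeMonoid as ICMSolver
open import Data.Product.Base using (_,_)
open import Function.Bundles using (Equivalence)
import Relation.Binary.Lattice as OrderLattice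
import Relation.Binary.Lattice.Structures as OrderStructures
import Relation.Binary.Reasoning.PartialOrder as ≤-Reasoning

-- Write 1_x = x ⇒ x for the local unit of x. In the monoidal order any two
-- elements have a join, for which there is an explicit formula:
--
--   x ⊔ z = x · (1_x ⇒ p) ∨ z · (1_z ⇒ p),   p = 1_x ∧ 1_z.
--
-- If x · y ⊑ z then z = (x ⊔ z) · (y ⊔ z). The only non-trivial term in the
-- expansion of the right-hand side is x · y · (1_x ⇒ p) · (1_y ⇒ q), where
-- q = 1_y ∧ 1_z; since x · y = x · y · z, its product with - z is below
-- p · q · (z · - z) ≤ 1_z · (z · - z) ≤ 0. For the other inequality one needs
-- 1_z ≤ p · q, which holds because 1_z ≤ 1_x · 1_y and the positive elements
-- form a distributive lattice with join _·_.
module CIdInRLProperties {c ℓ} (A : CIdInRL c ℓ) where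

  open CIdInRL A

  lattice : Lattice c ℓ
  lattice = record { isLattice = isLattice }

  open OrderLattice.Lattice
    (LatticeProperties.∨-∧-orderTheoreticLattice lattice)
    using (poset; antisym; x∧y≤x; x∧y≤y; ∧-greatest; x≤x∨y; y≤x∨y; ∨-least)
    renaming (refl to ≤-refl; trans to ≤-trans; reflexive to ≤-reflexive)

  open ≤-Reasoning poset

  ·-idempotentCommutativeMonoid : IdempotentCommutativeMonoid c ℓ
  ·-idempotentCommutativeMonoid = record
    { isIdempotentCommutativeMonoid = ·-isIdempotentCommutativeMonoid }

  open IdempotentCommutativeMonoid ·-idempotentCommutativeMonoid
    using () renaming (identityʳ to ·-identityʳ)

  open CommutativeSemigroupProperties
    (IdempotentCommutativeMonoid.commutativeSemigroup ·-idempotentCommutativeMonoid)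
    using (interchange; xy∙z≈xz∙y; x∙yz≈yx∙z)

  open ICMSolver ·-idempotentCommutativeMonoid using (solve; _⊕_; _⊜_)

  -- Residuation and monotonicity of multiplication.

  residuateʳ : ∀ {x y z} → x · y ≤ z → y ≤ x ⇒ z
  residuateʳ = Equivalence.to (residuation _ _ _)

  residuateˡ : ∀ {x y z} → y ≤ x ⇒ z → x · y ≤ z
  residuateˡ = Equivalence.from (residuation _ _ _)

  ·-monoʳ : ∀ x {y z} → y ≤ z → x · y ≤ x · z
  ·-monoʳ x y≤z = residuateˡ (≤-trans y≤z (residuateʳ ≤-refl))

  ·-mono : ∀ {w x y z} → w ≤ x → y ≤ z → w · y ≤ x · z
  ·-mono {w} {x} {y} {z} w≤x y≤z = begin
    w · y  ≤⟨ ·-monoʳ w y≤z ⟩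
    w · z  ≈⟨ ·-comm w z ⟩
    z · w  ≤⟨ ·-monoʳ z w≤x ⟩
    z · x  ≈⟨ ·-comm z x ⟩
    x · z  ∎

  ·-least : ∀ {x y z} → x ≤ z → y ≤ z → x · y ≤ z
  ·-least {z = z} x≤z y≤z = ≤-trans (·-mono x≤z y≤z) (≤-reflexive (·-idem z))

  1≤y⇒x≤x·y : ∀ {x y} → 1# ≤ y → x ≤ x · y
  1≤y⇒x≤x·y {x} 1≤y = ≤-trans (≤-reflexive (sym (·-identityʳ x))) (·-monoʳ x 1≤y)

  1≤x⇒y≤x·y : ∀ {x y} → 1# ≤ x → y ≤ x · y
  1≤x⇒y≤x·y {x} {y} 1≤x = ≤-trans (1≤y⇒x≤x·y 1≤x) (≤-reflexive (·-comm y x))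

  x·[x⇒y]≤y : ∀ x y → x · (x ⇒ y) ≤ y
  x·[x⇒y]≤y x y = residuateˡ ≤-refl

  ·-∨-least : ∀ {w x y z} → w · x ≤ z → w · y ≤ z → w · (x ∨ y) ≤ z
  ·-∨-least wx≤z wy≤z = residuateˡ (∨-least (residuateʳ wx≤z) (residuateʳ wy≤z))

  -- Involutive negation.

  x·-x≤0 : ∀ x → x · (- x) ≤ 0#
  x·-x≤0 x = x·[x⇒y]≤y x 0#

  -- Residuation gives `x ≤ - (- y)`. Most inequalities below are proved in this refutation form, in
  -- which idempotence allows factors to be duplicated.
  x·-y≤0⇒x≤y : ∀ {x y} → x · (- y) ≤ 0# → x ≤ y
  x·-y≤0⇒x≤y {x} {y} x·-y≤0 = begin
    x          ≤⟨ residuateʳ (≤-trans (≤-reflexive (·-comm (- y) x)) x·-y≤0) ⟩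
    - (- y)    ≈⟨ involutive y ⟩
    y          ∎

  x≤y⇒x·-y≤0 : ∀ {x y} → x ≤ y → x · (- y) ≤ 0#
  x≤y⇒x·-y≤0 {y = y} x≤y = ≤-trans (·-mono x≤y ≤-refl) (x·-x≤0 y)

  -‿antitone : ∀ {x y} → x ≤ y → - y ≤ - x
  -‿antitone x≤y = residuateʳ (x≤y⇒x·-y≤0 x≤y)

  -x≤y⇒-y≤x : ∀ {x y} → - x ≤ y → - y ≤ x
  -x≤y⇒-y≤x {x} -x≤y = ≤-trans (-‿antitone -x≤y) (≤-reflexive (involutive x))

  -[x∧y]≤-x∨-y : ∀ x y → - (x ∧ y) ≤ (- x) ∨ (- y)
  -[x∧y]≤-x∨-y x y = -x≤y⇒-y≤x
    (∧-greatest (-x≤y⇒-y≤x (x≤x∨y _ _)) (-x≤y⇒-y≤x (y≤x∨y _ _)))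

  1≤x⇒-x≤0 : ∀ {x} → 1# ≤ x → - x ≤ 0#
  1≤x⇒-x≤0 {x} 1≤x = ≤-trans (1≤x⇒y≤x·y 1≤x) (x·-x≤0 x)

  -- Local units and positive elements.

  unit : Carrier → Carrier
  unit x = x ⇒ x

  1≤unit : ∀ x → 1# ≤ unit x
  1≤unit x = residuateʳ (≤-reflexive (·-identityʳ x))

  x≤unit : ∀ x → x ≤ unit x
  x≤unit x = residuateʳ (≤-reflexive (·-idem x))

  x·unit≤x : ∀ x → x · unit x ≤ x
  x·unit≤x x = x·[x⇒y]≤y x x

  x·-x≤x : ∀ x → x · (- x) ≤ x
  x·-x≤x x = x·-y≤0⇒x≤y (begin
    (x · (- x)) · (- x)  ≈⟨ solve 2 (λ x -x → ((x ⊕ -x) ⊕ -x) ⊜ (x ⊕ -x)) refl x (- x) ⟩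
    x · (- x)            ≤⟨ x·-x≤0 x ⟩
    0#                   ∎)

  -- By contraposition and residuation it suffices that `x · (- (x · (- x))) ≤ x`; multiplying the
  -- left side by `- x` gives an element times its own negation.
  -unit≤x·-x : ∀ x → - unit x ≤ x · (- x)
  -unit≤x·-x x = -x≤y⇒-y≤x (residuateʳ (x·-y≤0⇒x≤y (begin
    (x · (- (x · (- x)))) · (- x)  ≈⟨ xy∙z≈xz∙y x _ (- x) ⟩
    (x · (- x)) · (- (x · (- x)))  ≤⟨ x·-x≤0 _ ⟩
    0#                             ∎)))

  -- The negation `n` of the right-hand side is below both `x · (- x)` and `y · (- y)`, because
  -- multiplying one unit by the other, a positive element, only enlarges it. Writing `n` as `n · n`
  -- makes both bounds available at once, so that a factor `x · y` appears and the hypothesis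
  -- removes `t`.
  t·xy≤xy⇒t≤unit·unit : ∀ {x y t} → t · (x · y) ≤ x · y → t ≤ unit x · unit y
  t·xy≤xy⇒t≤unit·unit {x} {y} {t} txy≤xy = x·-y≤0⇒x≤y (begin
    t · n                            ≈⟨ ·-cong refl (·-idem n) ⟨
    t · (n · n)                      ≤⟨ ·-monoʳ t (·-mono
                                          (n≤ x (1≤y⇒x≤x·y (1≤unit y)))
                                          (n≤ y (1≤x⇒y≤x·y (1≤unit x)))) ⟩
    t · ((x · (- x)) · (y · (- y)))  ≈⟨ solve 5 (λ t x -x y -y →
                                          (t ⊕ ((x ⊕ -x) ⊕ (y ⊕ -y))) ⊜
                                          ((t ⊕ (x ⊕ y)) ⊕ (-x ⊕ -y)))
                                          refl t x (- x) y (- y) ⟩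
    (t · (x · y)) · ((- x) · (- y))  ≤⟨ ·-mono txy≤xy ≤-refl ⟩
    (x · y) · ((- x) · (- y))        ≈⟨ interchange x y (- x) (- y) ⟩
    (x · (- x)) · (y · (- y))        ≤⟨ ·-least (x·-x≤0 x) (x·-x≤0 y) ⟩
    0#                               ∎)
    where
    n = - (unit x · unit y)

    n≤ : ∀ v → unit v ≤ unit x · unit y → n ≤ v · (- v)
    n≤ v unit≤ = ≤-trans (-‿antitone unit≤) (-unit≤x·-x v)

  -- Among positive elements `·` is the join, so this is the non-trivial half of the distributive
  -- law for `r ∧ (p · q)`, in the case `r ≤ p · q`.
  r≤p·q⇒r≤[p∧r]·[q∧r] : ∀ {p q r} → 1# ≤ p → 1# ≤ q → 1# ≤ r →
                        r ≤ p · q → r ≤ (p ∧ r) · (q ∧ r)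
  r≤p·q⇒r≤[p∧r]·[q∧r] {p} {q} {r} 1≤p 1≤q 1≤r r≤p·q = x·-y≤0⇒x≤y (begin
    r · n                                    ≈⟨ ·-cong refl (·-idem n) ⟨
    -- Each copy of `n` is bounded by dropping one positive factor under the negation and applying
    -- De Morgan. In the expansion only `r · (- p) · (- q)` calls for `r ≤ p · q`; every other
    -- product contains `r · (- r)`.
    r · (n · n)                              ≤⟨ ·-monoʳ r (·-mono n≤-q∨-r n≤-p∨-r) ⟩
    r · (((- q) ∨ (- r)) · ((- p) ∨ (- r)))  ≈⟨ ·-assoc r _ _ ⟨
    (r · ((- q) ∨ (- r))) · ((- p) ∨ (- r))  ≤⟨ ·-∨-least -p-term -r-term ⟩
    0#                                       ∎)
    where
    n = - ((p ∧ r) · (q ∧ r))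

    -p≤0 = 1≤x⇒-x≤0 1≤p
    -q≤0 = 1≤x⇒-x≤0 1≤q
    -r≤0 = 1≤x⇒-x≤0 1≤r

    n≤-p∨-r : n ≤ (- p) ∨ (- r)
    n≤-p∨-r = ≤-trans (-‿antitone (1≤y⇒x≤x·y (∧-greatest 1≤q 1≤r))) (-[x∧y]≤-x∨-y p r)

    n≤-q∨-r : n ≤ (- q) ∨ (- r)
    n≤-q∨-r = ≤-trans (-‿antitone (1≤x⇒y≤x·y (∧-greatest 1≤p 1≤r))) (-[x∧y]≤-x∨-y q r)

    -r-term : (r · ((- q) ∨ (- r))) · (- r) ≤ 0#
    -r-term = begin
      (r · ((- q) ∨ (- r))) · (- r)  ≈⟨ xy∙z≈xz∙y r _ (- r) ⟩
      (r · (- r)) · ((- q) ∨ (- r))  ≤⟨ ·-least (x·-x≤0 r) (∨-least -q≤0 -r≤0) ⟩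
      0#                             ∎

    -p-term : (r · ((- q) ∨ (- r))) · (- p) ≤ 0#
    -p-term = begin
      (r · ((- q) ∨ (- r))) · (- p)  ≈⟨ xy∙z≈xz∙y r _ (- p) ⟩
      (r · (- p)) · ((- q) ∨ (- r))  ≤⟨ ·-∨-least
        (begin
          (r · (- p)) · (- q)        ≈⟨ ·-assoc r (- p) (- q) ⟩
          r · ((- p) · (- q))        ≤⟨ ·-mono r≤p·q ≤-refl ⟩
          (p · q) · ((- p) · (- q))  ≈⟨ interchange p q (- p) (- q) ⟩
          (p · (- p)) · (q · (- q))  ≤⟨ ·-least (x·-x≤0 p) (x·-x≤0 q) ⟩
          0#                         ∎)
        (begin
          (r · (- p)) · (- r)        ≈⟨ xy∙z≈xz∙y r (- p) (- r) ⟩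
          (r · (- r)) · (- p)        ≤⟨ ·-least (x·-x≤0 r) -p≤0 ⟩
          0#                         ∎) ⟩
      0#                             ∎

  -- Upper bounds in the monoidal order.

  infixr 6 _⊔_

  _⊔_ : Carrier → Carrier → Carrier
  x ⊔ z = x · (unit x ⇒ (unit x ∧ unit z)) ∨ z · (unit z ⇒ (unit x ∧ unit z))

  unit⇒≤unit : ∀ {y} x → y ≤ unit x → unit x ⇒ y ≤ unit x
  unit⇒≤unit {y} x y≤unit = begin
    unit x ⇒ y             ≤⟨ 1≤x⇒y≤x·y (1≤unit x) ⟩
    unit x · (unit x ⇒ y)  ≤⟨ x·[x⇒y]≤y (unit x) y ⟩
    y                      ≤⟨ y≤unit ⟩
    unit x                 ∎

  x·[unit⇒y]≤y : ∀ x y → x · (unit x ⇒ y) ≤ y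
  x·[unit⇒y]≤y x y = ≤-trans (·-mono (x≤unit x) ≤-refl) (x·[x⇒y]≤y (unit x) y)

  ⊔≤units : ∀ x z → x ⊔ z ≤ unit x ∧ unit z
  ⊔≤units x z = ∨-least (x·[unit⇒y]≤y x _) (x·[unit⇒y]≤y z _)

  -- The element `- unit x` is idempotent and lies below each of the two factors, hence below their
  -- product.
  -unit≤x·[unit⇒y] : ∀ x {y} → 1# ≤ y → - unit x ≤ x · (unit x ⇒ y)
  -unit≤x·[unit⇒y] x {y} 1≤y = begin
    - unit x               ≈⟨ ·-idem (- unit x) ⟨
    - unit x · (- unit x)  ≤⟨ ·-mono (≤-trans (-unit≤x·-x x) (x·-x≤x x)) -unit≤unit⇒y ⟩
    x · (unit x ⇒ y)       ∎
    where
    -unit≤unit⇒y : - unit x ≤ unit x ⇒ y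
    -unit≤unit⇒y = residuateʳ (x·-y≤0⇒x≤y
      (·-least (x·-x≤0 (unit x)) (1≤x⇒-x≤0 1≤y)))

  -units≤⊔ : ∀ x z → - (unit x ∧ unit z) ≤ x ⊔ z
  -units≤⊔ x z = begin
    - (unit x ∧ unit z)        ≤⟨ -[x∧y]≤-x∨-y (unit x) (unit z) ⟩
    (- unit x) ∨ (- unit z)    ≤⟨ ∨-least
                                    (≤-trans (-unit≤x·[unit⇒y] x 1≤units) (x≤x∨y _ _))
                                    (≤-trans (-unit≤x·[unit⇒y] z 1≤units) (y≤x∨y _ _)) ⟩
    x ⊔ z                      ∎
    where
    1≤units : 1# ≤ unit x ∧ unit z
    1≤units = ∧-greatest (1≤unit x) (1≤unit z)

  -- The bound `w ≤ unit x` gives `x · w ≤ x`. For the converse, `- y ≤ w` forces `x · n ≤ y`, and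
  -- since `x · n` absorbs `unit x` this improves to `x · n ≤ unit x ⇒ y`; the remaining hypothesis
  -- then brings the product back below `w`.
  absorbs : ∀ {x y w} → - y ≤ w → x · (unit x ⇒ y) ≤ w → w ≤ unit x → x · w ≈ x
  absorbs {x} {y} {w} -y≤w x·[unit⇒y]≤w w≤unit = antisym
    (≤-trans (·-monoʳ x w≤unit) (x·unit≤x x))
    (x·-y≤0⇒x≤y (begin
      -- The copies are arranged so that the innermost `x · n` can be enlarged to `unit x ⇒ y`, the
      -- `x` before it completes a product below `w`, and the outer `x · n` refutes `w`.
      x · n                           ≈⟨ solve 2 (λ x n → (x ⊕ n) ⊜ ((x ⊕ n) ⊕ (x ⊕ (x ⊕ n))))
                                           refl x n ⟩
      (x · n) · (x · (x · n))         ≤⟨ ·-monoʳ (x · n) (·-monoʳ x x·n≤unit⇒y) ⟩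
      (x · n) · (x · (unit x ⇒ y))    ≤⟨ x·n·≤0 x·[unit⇒y]≤w ⟩
      0#                              ∎))
    where
    n = - (x · w)

    x·n·≤0 : ∀ {v} → v ≤ w → (x · n) · v ≤ 0#
    x·n·≤0 {v} v≤w = begin
      (x · n) · v  ≤⟨ ·-monoʳ (x · n) v≤w ⟩
      (x · n) · w  ≈⟨ xy∙z≈xz∙y x n w ⟩
      (x · w) · n  ≤⟨ x·-x≤0 (x · w) ⟩
      0#           ∎

    x·n≤unit⇒y : x · n ≤ unit x ⇒ y
    x·n≤unit⇒y = residuateʳ (begin
      unit x · (x · n)  ≈⟨ solve 3 (λ u x n → (u ⊕ (x ⊕ n)) ⊜ ((x ⊕ u) ⊕ n)) refl (unit x) x n ⟩
      (x · unit x) · n  ≤⟨ ·-mono (x·unit≤x x) ≤-refl ⟩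
      x · n             ≤⟨ x·-y≤0⇒x≤y (x·n·≤0 -y≤w) ⟩
      y                 ∎)

  ⊔-upperˡ : ∀ x z → x ⊑ x ⊔ z
  ⊔-upperˡ x z = absorbs (-units≤⊔ x z) (x≤x∨y _ _) (≤-trans (⊔≤units x z) (x∧y≤x _ _))

  ⊔-upperʳ : ∀ x z → z ⊑ x ⊔ z
  ⊔-upperʳ x z = absorbs (-units≤⊔ x z) (y≤x∨y _ _) (≤-trans (⊔≤units x z) (x∧y≤y _ _))

  -- Recovering `z` as a product of two upper bounds.

  [x⊔z]·[y⊔z]≤z : ∀ x y z → x · y ⊑ z → (x ⊔ z) · (y ⊔ z) ≤ z
  [x⊔z]·[y⊔z]≤z x y z xy⊑z = ·-∨-least
    (begin
      (x ⊔ z) · (y · b)                ≈⟨ ·-comm _ _ ⟩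
      (y · b) · (x ⊔ z)                ≤⟨ ·-∨-least xy-term (≤-trans
                                            (≤-reflexive (·-comm (y · b) _))
                                            (z-term (x∧y≤y _ _) y·b≤unit)) ⟩
      z                                ∎)
    -- Here `x ⊔ z` need not be expanded: as a whole it is below `unit z`, so the factor `z` absorbs
    -- it.
    (≤-trans (≤-reflexive (·-comm (x ⊔ z) _))
      (z-term (x∧y≤y _ _) (≤-trans (⊔≤units x z) (x∧y≤y _ _))))
    where
    p = unit x ∧ unit z
    q = unit y ∧ unit z
    a = unit x ⇒ p
    b = unit y ⇒ q

    x·a≤unit : x · a ≤ unit z
    x·a≤unit = ≤-trans (x·[unit⇒y]≤y x p) (x∧y≤y _ _)

    y·b≤unit : y · b ≤ unit z
    y·b≤unit = ≤-trans (x·[unit⇒y]≤y y q) (x∧y≤y _ _)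

    z·units≤z : ∀ {t u} → t ≤ unit z → u ≤ unit z → (z · t) · u ≤ z
    z·units≤z t≤unit u≤unit = ≤-trans (·-mono (residuateˡ t≤unit) ≤-refl) (residuateˡ u≤unit)

    z-term : ∀ {s t} → s ≤ unit z → t ≤ unit z → (z · (unit z ⇒ s)) · t ≤ z
    z-term s≤unit = z·units≤z (unit⇒≤unit z s≤unit)

    xy-term : (y · b) · (x · a) ≤ z
    xy-term = x·-y≤0⇒x≤y (begin
      ((y · b) · (x · a)) · (- z)              ≈⟨ solve 5 (λ x y a b n →
                                                    (((y ⊕ b) ⊕ (x ⊕ a)) ⊕ n) ⊜
                                                    ((x ⊕ y) ⊕ (((x ⊕ a) ⊕ (y ⊕ b)) ⊕ n)))
                                                    refl x y a b (- z) ⟩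
      (x · y) · (((x · a) · (y · b)) · (- z))  ≈⟨ ·-cong xy⊑z refl ⟨
      -- The hypothesis inserts a factor `z`, which absorbs `x · a` and `y · b`, both below
      -- `unit z`, and then meets `- z`.
      ((x · y) · z) · (((x · a) · (y · b)) · (- z))
                                               ≈⟨ solve 6 (λ x y z a b n →
                                                    (((x ⊕ y) ⊕ z) ⊕ (((x ⊕ a) ⊕ (y ⊕ b)) ⊕ n)) ⊜
                                                    (((z ⊕ (x ⊕ a)) ⊕ (y ⊕ b)) ⊕ n))
                                                    refl x y z a b (- z) ⟩
      ((z · (x · a)) · (y · b)) · (- z)        ≤⟨ x≤y⇒x·-y≤0 (z·units≤z x·a≤unit y·b≤unit) ⟩
      0#                                       ∎)

  -- Both upper bounds can be multiplied onto `z` without changing it. The original factor `z` is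
  -- then enlarged to `p · q`, and each upper bound absorbs its own meet of units.
  z≤[x⊔z]·[y⊔z] : ∀ x y z → x · y ⊑ z → z ≤ (x ⊔ z) · (y ⊔ z)
  z≤[x⊔z]·[y⊔z] x y z xy⊑z = begin
    z                                      ≈⟨ ⊔-upperʳ y z ⟨
    z · (y ⊔ z)                            ≈⟨ ·-cong (⊔-upperʳ x z) refl ⟨
    (z · (x ⊔ z)) · (y ⊔ z)                ≤⟨ ·-mono (·-mono z≤p·q ≤-refl) ≤-refl ⟩
    ((p · q) · (x ⊔ z)) · (y ⊔ z)          ≈⟨ solve 4 (λ p q u v →
                                                (((p ⊕ q) ⊕ u) ⊕ v) ⊜ ((u ⊕ p) ⊕ (v ⊕ q)))
                                                refl p q _ _ ⟩
    ((x ⊔ z) · p) · ((y ⊔ z) · q)          ≤⟨ ·-mono (⊔·units≤⊔ x) (⊔·units≤⊔ y) ⟩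
    (x ⊔ z) · (y ⊔ z)                      ∎
    where
    p = unit x ∧ unit z
    q = unit y ∧ unit z

    -- Since `x · y` equals `x · y · z`, it absorbs `unit z` through its factor `z`.
    unit-z≤unit·unit : unit z ≤ unit x · unit y
    unit-z≤unit·unit = t·xy≤xy⇒t≤unit·unit (begin
      unit z · (x · y)        ≈⟨ ·-cong refl xy⊑z ⟨
      unit z · ((x · y) · z)  ≈⟨ solve 3 (λ u w z → (u ⊕ (w ⊕ z)) ⊜ (w ⊕ (z ⊕ u)))
                                   refl (unit z) (x · y) z ⟩
      (x · y) · (z · unit z)  ≤⟨ ·-monoʳ (x · y) (x·unit≤x z) ⟩
      (x · y) · z             ≈⟨ xy⊑z ⟩
      x · y                   ∎)

    z≤p·q : z ≤ p · q
    z≤p·q = ≤-trans (x≤unit z)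
      (r≤p·q⇒r≤[p∧r]·[q∧r] (1≤unit x) (1≤unit y) (1≤unit z) unit-z≤unit·unit)

    -- Each summand is a multiple of `w` or of `z`, so it absorbs the corresponding local unit and
    -- everything below it.
    ⊔·units≤⊔ : ∀ w → (w ⊔ z) · (unit w ∧ unit z) ≤ w ⊔ z
    ⊔·units≤⊔ w = ≤-trans (≤-reflexive (·-comm _ _)) (·-∨-least
      (≤-trans (summand w (x∧y≤x _ _)) (x≤x∨y _ _))
      (≤-trans (summand z (x∧y≤y _ _)) (y≤x∨y _ _)))
      where
      summand : ∀ v {s t} → t ≤ unit v → t · (v · s) ≤ v · s
      summand v {s} {t} t≤unit = begin
        t · (v · s)       ≤⟨ ·-mono t≤unit ≤-refl ⟩
        unit v · (v · s)  ≈⟨ x∙yz≈yx∙z (unit v) v s ⟩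
        (v · unit v) · s  ≤⟨ ·-mono (x·unit≤x v) ≤-refl ⟩
        v · s             ∎

  ·-semilattice : Semilattice c ℓ
  ·-semilattice = record
    { isSemilattice = record
      { isBand = IdempotentCommutativeMonoid.isBand ·-idempotentCommutativeMonoid
      ; comm   = ·-comm
      }
    }

  ⊑-isMeetSemilattice : OrderStructures.IsMeetSemilattice _≈_ _⊑_ _·_
  ⊑-isMeetSemilattice = record
    { isPartialOrder = record
      { isPreorder = record
        { isEquivalence = isEquivalence
        -- The natural order of the semilattice is `x ≈ x · y`, the mirror image of `x ⊑ y`; this
        -- accounts for every `sym` here.
        ; reflexive     = λ x≈y → sym (N.reflexive x≈y)
        ; trans         = λ x⊑y y⊑z → sym (N.trans (sym x⊑y) (sym y⊑z))
        }
      ; antisym = λ x⊑y y⊑x → N.antisym (sym x⊑y) (sym y⊑x)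
      }
    ; infimum = λ x y →
        sym (N.x∧y≤x x y) , sym (N.x∧y≤y x y) ,
        λ z z⊑x z⊑y → sym (N.∧-greatest (sym z⊑x) (sym z⊑y))
    }
    where
    module N = OrderLattice.MeetSemilattice
      (SemilatticeProperties.∧-orderTheoreticMeetSemilattice ·-semilattice)

  ⊑-isDistributiveMeetSemilattice : IsDistributiveMeetSemilattice _≈_ _⊑_ _·_
  ⊑-isDistributiveMeetSemilattice = record
    { isMeetSemilattice = ⊑-isMeetSemilattice
    ; distributive      = λ x y z xy⊑z →
        x ⊔ z , y ⊔ z , ⊔-upperˡ x z , ⊔-upperˡ y z ,
        antisym (z≤[x⊔z]·[y⊔z] x y z xy⊑z) ([x⊔z]·[y⊔z]≤z x y z xy⊑z)
    }

theorem7p2 : ∀ {c ℓ} (A : CIdInRL c ℓ) → Finite (CIdInRL.setoid A) →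
    IsDistributiveMeetSemilattice (CIdInRL._≈_ A) (CIdInRL._⊑_ A) (CIdInRL._·_ A)
theorem7p2 A _ = CIdInRLProperties.⊑-isDistributiveMeetSemilattice A
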